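{- For all integers $w\geq0$ and $p\geq p_{w}$, the graph $G_{w,p}$ contains every tree with at most $\gamma(w,p)$ edges.
   Context: For integers $w,p\geq0$ define $\alpha(w,p)=\frac{1}{1+(2/3)^{w}}\Big(\frac{2+(2/3)^{w}}{1+(2/3)^{w}}\Big)^{p-1}$, $\gamma(w,p)=\Big(\frac{2+(2/3)^{w}}{1+(2/3)^{w}}\Big)^{p}$, $\beta(w)=3(\frac{3}{2})^{w}$ and $\delta(w)=(2+(\frac{2}{3})^{w})\beta(w)$. Let $p_w$ be the smallest integer such that $\alpha(w,p_w+1)\geq\beta(w)$. For $p\geq p_w$ define $G_{w,p}$ recursively: $G_{w,p_w}$ is the complete graph $K_{\lceil\delta(w)\rceil}$, and for $p\geq p_w+1$, $G_{w,p}$ is obtained from a complete graph $K_{w+1}$ and two disjoint copies of $G_{w,p-1}$ by adding all edges between the vertices of $K_{w+1}$ and the vertices of the two copies. A graph $U$ contains a graph $H$ if some subgraph of $U$ is isomorphic to $H$. -}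

module Defs where

open import Data.Nat as ℕ using (ℕ; zero; suc; _+_; _*_; _^_; _∸_; NonZero; >-nonZero; _<ᵇ_)
open import Data.Nat.Properties using (m^n>0; m≤m+n; <-≤-trans; ≤-trans)
open import Data.Integer as ℤ using (ℤ; +_)
open import Data.Rational as ℚ using (ℚ; _/_; 1ℚ; ceiling)
open import Data.Fin using (Fin; zero; suc; inject₁; fromℕ; toℕ)
open import Data.Sum using (_⊎_; inj₁; inj₂)
open import Data.Product using (Σ; ∃; _×_; _,_)
open import Data.Bool using (Bool; true; false; if_then_else_; _∧_)
open import Data.List using (List; map; allFin)
open import Data.Nat.ListAction using (sum)
open import Data.Unit using (⊤)
open import Data.Empty using (⊥)
open import Function.Definitions using (Injective)
open import Relation.Binary.PropositionalEquality using (_≡_; _≢_)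

-- The rational constants.  Throughout, write a = 3^w and b = 2^w, so
-- (2/3)^w = b/a.  Then
--   1/(1+(2/3)^w)                 = a/(a+b)
--   (2+(2/3)^w)/(1+(2/3)^w)       = (2a+b)/(a+b)
--   β(w) = 3 (3/2)^w              = 3a/b
--   2 + (2/3)^w                   = (2a+b)/a

powℚ : ℚ → ℕ → ℚ
powℚ q zero    = 1ℚ
powℚ q (suc n) = q ℚ.* powℚ q n

nzab : ∀ w → NonZero (3 ^ w + 2 ^ w)
nzab w = >-nonZero (<-≤-trans (m^n>0 3 w) (m≤m+n (3 ^ w) (2 ^ w)))

nz2ab : ∀ w → NonZero (2 * 3 ^ w + 2 ^ w)
nz2ab w = >-nonZero (<-≤-trans (m^n>0 3 w) (≤-trans (m≤m+n (3 ^ w) (1 * 3 ^ w)) (m≤m+n (2 * 3 ^ w) (2 ^ w))))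

nza : ∀ w → NonZero (3 ^ w)
nza w = >-nonZero (m^n>0 3 w)

nzb : ∀ w → NonZero (2 ^ w)
nzb w = >-nonZero (m^n>0 2 w)

-- 1 / (1 + (2/3)^w)
invOnePlus : ℕ → ℚ
invOnePlus w = _/_ (+ (3 ^ w)) (3 ^ w + 2 ^ w) {{nzab w}}

-- (2 + (2/3)^w) / (1 + (2/3)^w)
ratio : ℕ → ℚ
ratio w = _/_ (+ (2 * 3 ^ w + 2 ^ w)) (3 ^ w + 2 ^ w) {{nzab w}}

-- α(w,p) = 1/(1+(2/3)^w) · ratio(w)^(p-1).  For p = 0 the exponent is -1,
-- giving (1/(1+x)) · (1+x)/(2+x) = 1/(2+(2/3)^w) = a/(2a+b).
α : ℕ → ℕ → ℚ
α w zero    = _/_ (+ (3 ^ w)) (2 * 3 ^ w + 2 ^ w) {{nz2ab w}}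
α w (suc p) = invOnePlus w ℚ.* powℚ (ratio w) p

γ : ℕ → ℕ → ℚ
γ w p = powℚ (ratio w) p

β : ℕ → ℚ
β w = _/_ (+ (3 * 3 ^ w)) (2 ^ w) {{nzb w}}

-- δ(w) = (2 + (2/3)^w) β(w)
δ : ℕ → ℚ
δ w = _/_ (+ (2 * 3 ^ w + 2 ^ w)) (3 ^ w) {{nza w}} ℚ.* β w

IsPw : ℕ → ℕ → Set
IsPw w pw = (β w ℚ.≤ α w (suc pw)) × (∀ q → β w ℚ.≤ α w (suc q) → pw ℕ.≤ q)

record Graph : Set₁ where
  field
    V : Set
    E : V → V → Set
open Graph public

Contains : Graph → Graph → Set
Contains U H = Σ (V H → V U) λ f → Injective _≡_ _≡_ f × (∀ {u v} → E H u v → E U (f u) (f v))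

K : ℕ → Graph
K n = record { V = Fin n ; E = λ i j → i ≢ j }

-- join of K_{w+1} with two disjoint copies of H
stepE : ∀ {A : Set} (w : ℕ) → (A → A → Set) → (Fin (suc w) ⊎ (A ⊎ A)) → (Fin (suc w) ⊎ (A ⊎ A)) → Set
stepE w e (inj₁ i) (inj₁ j) = i ≢ j
stepE w e (inj₁ _) (inj₂ _) = ⊤
stepE w e (inj₂ _) (inj₁ _) = ⊤
stepE w e (inj₂ (inj₁ x)) (inj₂ (inj₁ y)) = e x y
stepE w e (inj₂ (inj₂ x)) (inj₂ (inj₂ y)) = e x y
stepE w e (inj₂ (inj₁ _)) (inj₂ (inj₂ _)) = ⊥
stepE w e (inj₂ (inj₂ _)) (inj₂ (inj₁ _)) = ⊥

step : ℕ → Graph → Graph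
step w H = record { V = Fin (suc w) ⊎ (V H ⊎ V H) ; E = stepE w (E H) }

iter : ℕ → ℕ → ℕ → Graph
iter w n zero    = K n
iter w n (suc k) = step w (iter w n k)

-- G_{w,p}, given p_w (meaningful for p ≥ p_w): G_{w,p_w} = K_{⌈δ(w)⌉}
G : (w pw p : ℕ) → Graph
G w pw p = iter w ℤ.∣ ceiling (δ w) ∣ (p ∸ pw)

record FinGraph (n : ℕ) : Set where
  field
    adj    : Fin n → Fin n → Bool
    sym    : ∀ i j → adj i j ≡ adj j i
    irrefl : ∀ i → adj i i ≡ false
open FinGraph public

Adj : ∀ {n} → FinGraph n → Fin n → Fin n → Set
Adj g i j = adj g i j ≡ true

toGraph : ∀ {n} → FinGraph n → Graph
toGraph {n} g = record { V = Fin n ; E = Adj g }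

edgeCount : ∀ {n} → FinGraph n → ℕ
edgeCount {n} g =
  sum (map (λ i → sum (map (λ j → if adj g i j ∧ (toℕ i <ᵇ toℕ j) then 1 else 0) (allFin n))) (allFin n))

Walk : ∀ {n} → FinGraph n → Fin n → Fin n → Set
Walk {n} g u v = Σ ℕ λ k → Σ (Fin (suc k) → Fin n) λ f →
  (f zero ≡ u) × (f (fromℕ k) ≡ v) × (∀ (i : Fin k) → Adj g (f (inject₁ i)) (f (suc i)))

Connected : ∀ {n} → FinGraph n → Set
Connected g = ∀ u v → Walk g u v

Cycle : ∀ {n} → FinGraph n → Set
Cycle {n} g = Σ ℕ λ k → Σ (Fin (3 + k) → Fin n) λ c →
  Injective _≡_ _≡_ c ×
  (∀ (i : Fin (2 + k)) → Adj g (c (inject₁ i)) (c (suc i))) ×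
  Adj g (c (fromℕ (2 + k))) (c zero)

Acyclic : ∀ {n} → FinGraph n → Set
Acyclic g = Cycle g → ⊥

IsTree : ∀ {n} → FinGraph n → Set
IsTree {n} g = (0 ℕ.< n) × Connected g × Acyclic g

{-# OPTIONS --safe #-}
module Submission where

-- Write a = 3^w, b = 2^w, c = a + b and d = 2a + b, so that γ(w,p) = (d/c)^p.
-- A forest with more than t vertices has at most w + 1 vertices whose removal
-- leaves components that can be grouped into a part with at most t + 1 + e
-- vertices, where e ≤ (2/3)^w t, and a part with at least t + 1 vertices fewer
-- than the whole forest.  For w = 0 take a lowest vertex below which there are at
-- least t vertices, and collect the trees below it greedily; every further vertex
-- moves about half of the excess of the first part over t + 1 to the second.  With
-- t = ⌊a d^(p-1) / c^p⌋ both parts are small enough to be embedded in the two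
-- copies of G_{w,p-1}, by induction.  At p = p_w the minimality of p_w gives
-- γ(w,p_w) < δ(w), so that K_⌈δ(w)⌉ has enough vertices.

open import Defs renaming (sym to adj-sym; irrefl to adj-irrefl)
open import Data.Bool using (true; if_then_else_; _∧_)
import Data.Bool.Properties as Bool
open import Data.Empty using (⊥; ⊥-elim)
open import Data.Fin using (Fin; zero; suc; toℕ; fromℕ; fromℕ<; inject₁; inject≤)
open import Data.Fin.Properties as Fin
  using (toℕ-inject₁; toℕ-fromℕ; toℕ<n; toℕ-injective; inject≤-injective; injective⇒≤)
open import Data.Integer as ℤ using (ℤ; +_)
import Data.Integer.DivMod as ℤ
import Data.Integer.Properties as ℤ
open import Data.List using (List; []; _∷_; [_]; _++_; length; map; allFin)
open import Data.List.Membership.Propositional using (_∈_; find; lose)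
open import Data.List.Membership.Propositional.Properties
  using (∈-++⁺ˡ; ∈-++⁺ʳ; ∈-++⁻; ∈-∃++; ∈-allFin)
import Data.List.Membership.DecPropositional as DecMembership
open import Data.List.Membership.Setoid.Properties using (index-injective)
open import Data.List.Properties using (length-++; length-tabulate; map-cong; ++-identityʳ)
open import Data.List.Relation.Binary.Disjoint.Propositional using (Disjoint)
open import Data.List.Relation.Binary.Permutation.Propositional
  using (_↭_; ↭-refl; ↭-sym; ↭-trans; ↭-prep; ↭-reflexive; ↭⇒↭ₛ)
open import Data.List.Relation.Binary.Permutation.Propositional.Properties as ↭
  using (∈-resp-↭; ++⁺ˡ; ++⁺ʳ; shift; ↭-length; map⁺)
import Data.List.Relation.Binary.Permutation.Setoid.Properties as Permutationₛ
import Data.List.Relation.Unary.All as All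
open import Data.List.Relation.Unary.AllPairs using ([]; _∷_)
open import Data.List.Relation.Unary.Any using (here; there; index; any?)
open import Data.List.Relation.Unary.Unique.Propositional using (Unique)
open import Data.List.Relation.Unary.Unique.Propositional.Properties using (allFin⁺)
open import Data.Nat as ℕ hiding (_/_; _≟_)
open import Data.Nat.DivMod using (m/n*n≤m; m≡m%n+[m/n]*n; m%n<n)
open import Data.Nat.ListAction using (sum)
open import Data.Nat.ListAction.Properties using (sum-↭)
open import Data.Nat.Properties hiding (_≟_)
open import Data.Nat.Tactic.RingSolver using (solve-∀)
open import Data.Product using (∃; ∃₂; _×_; _,_; proj₁; proj₂)
open import Data.Rational as ℚ using (ℚ; _/_; toℚᵘ; floor; ceiling; ↥_; ↧_)
import Data.Rational.Properties as ℚ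
open import Data.Rational.Unnormalised as ℚᵘ using (mkℚᵘ; *≡*; *≤*; *<*)
import Data.Rational.Unnormalised.Properties as ℚᵘ
open import Data.Sum as Sum using (_⊎_; inj₁; inj₂; map₂; [_,_]′)
open import Data.Sum.Properties using (inj₁-injective; inj₂-injective)
open import Data.Unit using (⊤; tt)
open import Function using (_∘_; id)
open import Relation.Binary.Definitions using (DecidableEquality; tri<; tri≈; tri>)
open import Relation.Binary.PropositionalEquality
  using (_≡_; _≢_; refl; sym; trans; cong; cong₂; subst; subst₂; setoid)
open import Relation.Nullary using (yes; no; ¬?)
open import Relation.Nullary.Decidable using (_×-dec_; decidable-stable)

-- Separating a forest

module ↭-Solver {A : Set} where
  open import Algebra.Solver.CommutativeMonoid (↭.++-commutativeMonoid {A = A}) public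
    using (solve; _⊜_; _⊕_)

-- node a cs ss is a first tree, with root a and subtrees cs, followed by the trees ss
data Forest (A : Set) : Set where
  ∅    : Forest A
  node : A → Forest A → Forest A → Forest A

module _ {A : Set} where

  verts : Forest A → List A
  verts ∅              = []
  verts (node a cs ss) = a ∷ verts cs ++ verts ss

  size : Forest A → ℕ
  size ∅              = 0
  size (node a cs ss) = suc (size cs + size ss)

  roots : Forest A → List A
  roots ∅              = []
  roots (node a cs ss) = a ∷ roots ss

  data Edge : Forest A → A → A → Set where
    top      : ∀ {a c cs ss} → c ∈ roots cs → Edge (node a cs ss) a c
    inside   : ∀ {a u v cs ss} → Edge cs u v → Edge (node a cs ss) u v
    sideways : ∀ {a u v cs ss} → Edge ss u v → Edge (node a cs ss) u v

  infixr 5 _⊕ᶠ_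
  _⊕ᶠ_ : Forest A → Forest A → Forest A
  ∅            ⊕ᶠ G = G
  node a cs ss ⊕ᶠ G = node a cs (ss ⊕ᶠ G)

  length-verts : ∀ F → length (verts F) ≡ size F
  length-verts ∅              = refl
  length-verts (node a cs ss) = cong suc
    (trans (length-++ (verts cs)) (cong₂ _+_ (length-verts cs) (length-verts ss)))

  verts-⊕ᶠ : ∀ F G → verts (F ⊕ᶠ G) ↭ verts F ++ verts G
  verts-⊕ᶠ ∅              G = ↭-refl
  verts-⊕ᶠ (node a cs ss) G = ↭-prep a (↭-trans (++⁺ˡ (verts cs) (verts-⊕ᶠ ss G))
    (↭-sym (↭.++-assoc (verts cs) (verts ss) (verts G))))

  Edge-⊕ᶠˡ : ∀ {F u v} G → Edge F u v → Edge (F ⊕ᶠ G) u v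
  Edge-⊕ᶠˡ G (top c∈)     = top c∈
  Edge-⊕ᶠˡ G (inside e)   = inside e
  Edge-⊕ᶠˡ G (sideways e) = sideways (Edge-⊕ᶠˡ G e)

  Edge-⊕ᶠʳ : ∀ {G u v} F → Edge G u v → Edge (F ⊕ᶠ G) u v
  Edge-⊕ᶠʳ ∅              e = e
  Edge-⊕ᶠʳ (node a cs ss) e = sideways (Edge-⊕ᶠʳ ss e)

  roots-⊕ᶠʳ : ∀ {x} F G → x ∈ roots G → x ∈ roots (F ⊕ᶠ G)
  roots-⊕ᶠʳ ∅              G x∈ = x∈
  roots-⊕ᶠʳ (node a cs ss) G x∈ = there (roots-⊕ᶠʳ ss G x∈)

  roots⊆verts : ∀ {x} F → x ∈ roots F → x ∈ verts F
  roots⊆verts (node a cs ss) (here eq)  = here eq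
  roots⊆verts (node a cs ss) (there x∈) = there (∈-++⁺ʳ (verts cs) (roots⊆verts ss x∈))

  -- `edge` only forbids losing edges of `F`. `left` and `right` may carry further edges, which does
  -- no harm to an embedding.
  record Split (F : Forest A) : Set where
    field
      sep   : List A
      left  : Forest A
      right : Forest A
      cover : verts F ↭ sep ++ verts left ++ verts right
      edge  : ∀ {u v} → Edge F u v → (u ∈ sep ⊎ v ∈ sep) ⊎ (Edge left u v ⊎ Edge right u v)

    order : length sep + (size left + size right) ≡ size F
    order = sym (trans (sym (length-verts F)) (trans (↭-length cover)
      (trans (length-++ sep) (cong (λ k → length sep + k) (trans (length-++ (verts left))
        (cong₂ _+_ (length-verts left) (length-verts right)))))))

  open Split

  SmallTrees : ℕ → Forest A → Set
  SmallTrees l ∅              = ⊤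
  SmallTrees l (node a cs ss) = suc (size cs) ≤ l × SmallTrees l ss

  record Part (F B C : Forest A) : Set where
    field
      pcover : verts F ↭ verts B ++ verts C
      pedge  : ∀ {u v} → Edge F u v → Edge B u v ⊎ Edge C u v
      proots : ∀ {x} → x ∈ roots F → x ∈ roots B ⊎ x ∈ roots C
  open Part

  -- Trees are dropped from the front while the rest still has `t` vertices. Where this stops, the
  -- rest without its first tree has fewer than `t`, so the overshoot is less than one tree.
  greedy : ∀ l t F → SmallTrees l F → t ≤ size F →
    ∃ λ B → ∃ λ C → Part F B C × t ≤ size B × size B ≤ t + l
  greedy l t ∅ _ t≤0 = ∅ , ∅ , record { pcover = ↭-refl ; pedge = inj₁ ; proots = inj₁ } , t≤0 , z≤n
  greedy l t F@(node a cs ss) (small , smalls) t≤ with t ≤? size ss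
  ... | yes t≤ss = let B , C , p , lo , hi = greedy l t ss smalls t≤ss in
    B , node a cs C , record
      { pcover = ↭-trans (↭-prep a (++⁺ˡ (verts cs) (pcover p)))
          (solve 4 (λ x c b r → x ⊕ (c ⊕ (b ⊕ r)) ⊜ b ⊕ (x ⊕ (c ⊕ r))) ↭-refl [ a ] (verts cs) (verts B) (verts C))
      ; pedge  = λ { (top c∈) → inj₂ (top c∈) ; (inside e) → inj₂ (inside e)
                   ; (sideways e) → map₂ sideways (pedge p e) }
      ; proots = λ { (here eq) → inj₂ (here eq) ; (there x∈) → map₂ there (proots p x∈) }
      } , lo , hi
    where open ↭-Solver
  ... | no t≰ss = F , ∅ , record
      { pcover = ↭-sym (↭.++-identityʳ (verts F)) ; pedge = inj₁ ; proots = inj₁ } , t≤ , bound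
    where
    bound : suc (size cs + size ss) ≤ t + l
    bound = ≤-trans (≤-reflexive (+-comm (suc (size cs)) (size ss))) (+-mono-≤ (<⇒≤ (≰⇒> t≰ss)) small)

  -- The separating vertex is counted with `left`, so the bounds control how much is withheld from
  -- `right`.
  record Cut (l : ℕ) (F : Forest A) : Set where
    field
      split  : Split F
      single : length (sep split) ≤ 1
      lower  : l ≤ length (sep split) + size (left split)
      upper  : length (sep split) + size (left split) < l + l

  -- The roots of F stay in the separator or the right part, so that the parts
  -- remain separated when F is a forest of children of a common vertex.
  record DeepCut (l : ℕ) (F : Forest A) : Set where
    field
      cut   : Cut l F
    open Cut cut public
    field
      above : ∀ {x} → x ∈ roots F → x ∈ sep split ⊎ x ∈ roots (right split)

  -- If some tree has more than `l` vertices, the recursion reaches a vertex whose tree is that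
  -- large while all trees below it are small. That vertex is removed, and the left part is
  -- collected greedily from below it.
  smallTrees⊎deepCut : ∀ l F → SmallTrees l F ⊎ DeepCut (suc l) F
  smallTrees⊎deepCut l ∅ = inj₁ tt
  smallTrees⊎deepCut l (node a cs ss) with smallTrees⊎deepCut l ss
  ... | inj₂ d = inj₂ record
    { cut = record
      { split = record
        { sep = sep s ; left = left s ; right = node a cs (right s)
        ; cover = ↭-trans (↭-prep a (++⁺ˡ (verts cs) (cover s)))
            (solve 5 (λ x c p q r → x ⊕ (c ⊕ (p ⊕ (q ⊕ r))) ⊜ p ⊕ (q ⊕ (x ⊕ (c ⊕ r)))) ↭-refl
              [ a ] (verts cs) (sep s) (verts (left s)) (verts (right s)))
        ; edge = λ { (top c∈) → inj₂ (inj₂ (top c∈)) ; (inside e) → inj₂ (inj₂ (inside e))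
                   ; (sideways e) → map₂ (map₂ sideways) (edge s e) } }
      ; single = single ; lower = lower ; upper = upper }
    ; above = λ { (here eq) → inj₂ (here eq) ; (there x∈) → map₂ there (above x∈) } }
    where open DeepCut d renaming (split to s)
          open ↭-Solver
  ... | inj₁ smalls with suc (size cs) ≤? l
  ... | yes small = inj₁ (small , smalls)
  ... | no ¬small with smallTrees⊎deepCut l cs
  ... | inj₂ d = inj₂ record
    { cut = record
      { split = record
        -- Subtrees orphaned by the removed vertex may be among the roots of `right s` and become
        -- children of `a`; `Split` allows these extra edges.
        { sep = sep s ; left = left s ; right = node a (right s) ss
        ; cover = ↭-trans (↭-prep a (++⁺ʳ (verts ss) (cover s)))
            (solve 5 (λ x c p q r → x ⊕ ((p ⊕ (q ⊕ r)) ⊕ c) ⊜ p ⊕ (q ⊕ (x ⊕ (r ⊕ c)))) ↭-refl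
              [ a ] (verts ss) (sep s) (verts (left s)) (verts (right s)))
        ; edge = λ { (top c∈) → [ inj₁ ∘ inj₂ , inj₂ ∘ inj₂ ∘ top ]′ (above c∈)
                   ; (inside e) → map₂ (map₂ inside) (edge s e)
                   ; (sideways e) → inj₂ (inj₂ (sideways e)) } }
      ; single = single ; lower = lower ; upper = upper }
    ; above = λ { (here eq) → inj₂ (here eq) ; (there x∈) → inj₂ (there x∈) } }
    where open DeepCut d renaming (split to s)
          open ↭-Solver
  ... | inj₁ smallcs =
    -- At least `l` vertices lie below `a`. Between `l` and `2l` of them are collected, so with `a`
    -- the count is between `l + 1` and `2l + 1`.
    let B , C , p , lo , hi = greedy l l cs smallcs (≤-pred (≰⇒> ¬small)) in
    inj₂ record
    { cut = record
      { split = record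
        { sep = [ a ] ; left = B ; right = C ⊕ᶠ ss
        ; cover = ↭-prep a (↭-trans (++⁺ʳ (verts ss) (pcover p))
            (↭-trans (↭.++-assoc (verts B) (verts C) (verts ss))
              (++⁺ˡ (verts B) (↭-sym (verts-⊕ᶠ C ss)))))
        ; edge = λ { (top c∈) → inj₁ (inj₁ (here refl))
                   ; (inside e) → inj₂ (map₂ (Edge-⊕ᶠˡ ss) (pedge p e))
                   ; (sideways e) → inj₂ (inj₂ (Edge-⊕ᶠʳ C e)) } }
      ; single = s≤s z≤n ; lower = s≤s lo
      ; upper = s≤s (≤-trans (s≤s hi) (≤-reflexive (sym (+-suc l l)))) }
    ; above = λ { (here eq) → inj₁ (here eq) ; (there x∈) → inj₂ (roots-⊕ᶠʳ C ss x∈) } }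

  cut-exists : ∀ l F → suc l ≤ size F → Cut (suc l) F
  cut-exists l F l<F with smallTrees⊎deepCut l F
  ... | inj₂ d = DeepCut.cut d
  ... | inj₁ smalls =
    -- No vertex has to be removed: whole trees of at most `l` vertices are collected, and their
    -- total lies between `l + 1` and `2l + 1`.
    let B , C , p , lo , hi = greedy l (suc l) F smalls l<F in record
    { split = record { sep = [] ; left = B ; right = C ; cover = pcover p ; edge = inj₂ ∘ pedge p }
    ; single = z≤n ; lower = lo ; upper = ≤-trans (s≤s hi) (≤-reflexive (sym (+-suc (suc l) l))) }

  trivialSplit : (F : Forest A) → Split F
  trivialSplit F = record
    { sep = [] ; left = F ; right = ∅ ; cover = ↭-sym (↭.++-identityʳ (verts F)) ; edge = inj₂ ∘ inj₁ }

  -- Cutting a second time in the left part moves vertices to the right part.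
  refine : ∀ {F} (s : Split F) → Split (left s) → Split F
  refine s s′ = record
    { sep = sep s ++ sep s′ ; left = right s′ ; right = left s′ ⊕ᶠ right s
    ; cover = ↭-trans (cover s) (↭-trans (++⁺ˡ (sep s) (++⁺ʳ (verts (right s)) (cover s′)))
        (↭-trans (solve 5 (λ p q l r z → p ⊕ ((q ⊕ (l ⊕ r)) ⊕ z) ⊜ (p ⊕ q) ⊕ (r ⊕ (l ⊕ z))) ↭-refl
                    (sep s) (sep s′) (verts (left s′)) (verts (right s′)) (verts (right s)))
          (++⁺ˡ (sep s ++ sep s′) (++⁺ˡ (verts (right s′)) (↭-sym (verts-⊕ᶠ (left s′) (right s)))))))
    ; edge = λ e → [ inj₁ ∘ [ inj₁ ∘ ∈-++⁺ˡ , inj₂ ∘ ∈-++⁺ˡ ]′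
                   , [ (λ e₁ → [ inj₁ ∘ [ inj₁ ∘ ∈-++⁺ʳ (sep s) , inj₂ ∘ ∈-++⁺ʳ (sep s) ]′
                               , inj₂ ∘ [ inj₂ ∘ Edge-⊕ᶠˡ (right s) , inj₁ ]′ ]′ (edge s′ e₁))
                     , inj₂ ∘ inj₂ ∘ Edge-⊕ᶠʳ (left s′) ]′ ]′ (edge s e) }
    where open ↭-Solver

  record Separator (w t : ℕ) (F : Forest A) : Set where
    field
      split  : Split F
      excess : ℕ
      few    : length (sep split) ≤ suc w
      scaled : 3 ^ w * excess ≤ 2 ^ w * t
      leftˢ  : size (left split) ≤ suc t + excess
      rightˢ : size (right split) + suc t ≤ size F

  -- Induction on `w`: one more vertex brings the left part closer to `t + 1` vertices but never
  -- below, which preserves `rightˢ`.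
  separator : ∀ w t F → suc t ≤ size F → Separator w t F
  -- One cut withholds at most `2t + 1` vertices, hence the initial excess `t`.
  separator zero t F t<F = record
    { split = split ; excess = t ; few = single ; scaled = ≤-refl
    ; leftˢ = ≤-trans (m≤n+m _ (length (sep split))) (≤-pred (≤-trans upper (≤-reflexive (+-suc (suc t) t))))
    ; rightˢ = begin
        size (right split) + suc t                                       ≤⟨ +-monoʳ-≤ (size (right split)) lower ⟩
        size (right split) + (length (sep split) + size (left split))    ≡⟨ rotate (size (right split)) (length (sep split)) _ ⟩
        length (sep split) + (size (left split) + size (right split))    ≡⟨ order split ⟩
        size F                                                           ∎ }
    where
    open Cut (cut-exists t F t<F)
    open ≤-Reasoning
    rotate : ∀ x y z → x + (y + z) ≡ y + (z + x)
    rotate = solve-∀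
  separator (suc w) t F t<F with separator w t F t<F
  ... | sp with size (left (Separator.split sp)) ≤? suc t
  -- Nothing is left to trim, so the old split serves with excess 0.
  ... | yes left≤ = record
    { split = split ; excess = 0 ; few = m≤n⇒m≤1+n few
    ; scaled = ≤-trans (≤-reflexive (*-zeroʳ (3 ^ suc w))) z≤n
    ; leftˢ = ≤-trans left≤ (m≤m+n (suc t) 0) ; rightˢ = rightˢ }
    where open Separator sp
  ... | no ¬left≤ with m≤n⇒∃[o]m+o≡n (≰⇒> ¬left≤)
  -- `e` counts the vertices beyond `t + 2`; the overshoot beyond `t + 1` is `suc e`.
  ... | e , left≡ = record
    { split = r ; excess = h ; few = few′ ; scaled = scaled′
    ; leftˢ = left′ ; rightˢ = right′ }
    where
    open Separator sp renaming (split to s)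
    open ≤-Reasoning

    -- A cut at `suc l` takes between `l + 1` and `2l + 1` of the `t + 2 + l + h` vertices, which
    -- leaves between `t + 1` and `t + 1 + h`.
    l h : ℕ
    l = ⌊ e /2⌋
    h = ⌈ e /2⌉

    l+h≡e : l + h ≡ e
    l+h≡e = ⌊n/2⌋+⌈n/2⌉≡n e

    c : Cut (suc l) (left s)
    c = cut-exists l (left s) (begin
      suc l            ≤⟨ s≤s (⌊n/2⌋≤n e) ⟩
      suc e            ≤⟨ s≤s (m≤n+m e (suc t)) ⟩
      suc (suc t) + e  ≡⟨ left≡ ⟩
      size (left s)    ∎)

    open Cut c renaming (split to s′)

    r : Split F
    r = refine s s′

    b x : ℕ
    b = length (sep s′) + size (left s′)
    x = size (right s′)

    b+x≡ : b + x ≡ suc (suc t) + (l + h)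
    b+x≡ = trans (+-assoc (length (sep s′)) _ _)
      (trans (order s′) (trans (sym left≡) (cong (λ k → suc (suc t) + k) (sym l+h≡e))))

    few′ : length (sep s ++ sep s′) ≤ suc (suc w)
    few′ = begin
      length (sep s ++ sep s′)          ≡⟨ length-++ (sep s) ⟩
      length (sep s) + length (sep s′)  ≤⟨ +-mono-≤ few single ⟩
      suc w + 1                         ≡⟨ +-comm (suc w) 1 ⟩
      suc (suc w)                       ∎

    left′ : x ≤ suc t + h
    left′ = +-cancelˡ-≤ (suc l) x (suc t + h) (begin
      suc l + x                ≤⟨ +-monoˡ-≤ x lower ⟩
      b + x                    ≡⟨ b+x≡ ⟩
      suc (suc t) + (l + h)    ≡⟨ arrange t l h ⟩
      suc l + (suc t + h)      ∎)
      where
      arrange : ∀ t l h → suc (suc t) + (l + h) ≡ suc l + (suc t + h)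
      arrange = solve-∀

    x≥ : suc t ≤ x
    x≥ = +-cancelˡ-≤ (suc (l + l)) (suc t) x (begin
      suc (l + l) + suc t      ≡⟨ arrange t l ⟩
      suc (suc t) + (l + l)    ≤⟨ +-monoʳ-≤ (suc (suc t)) (+-monoʳ-≤ l (⌊n/2⌋≤⌈n/2⌉ e)) ⟩
      suc (suc t) + (l + h)    ≡⟨ b+x≡ ⟨
      b + x                    ≤⟨ +-monoˡ-≤ x (≤-pred (≤-trans upper (≤-reflexive (cong suc (+-suc l l))))) ⟩
      suc (l + l) + x          ∎)
      where
      arrange : ∀ t l → suc (l + l) + suc t ≡ suc (suc t) + (l + l)
      arrange = solve-∀

    right′ : size (right r) + suc t ≤ size F
    right′ = begin
      size (right r) + suc t                            ≤⟨ +-monoʳ-≤ (size (right r)) x≥ ⟩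
      size (right r) + x                                ≡⟨ +-comm (size (right r)) x ⟩
      x + size (right r)                                ≤⟨ m≤n+m _ (length (sep r)) ⟩
      length (sep r) + (size (left r) + size (right r)) ≡⟨ order r ⟩
      size F                                            ∎

    e<excess : suc e ≤ excess
    e<excess = +-cancelˡ-≤ (suc t) (suc e) excess (begin
      suc t + suc e    ≡⟨ +-suc (suc t) e ⟩
      suc (suc t) + e  ≡⟨ left≡ ⟩
      size (left s)    ≤⟨ leftˢ ⟩
      suc t + excess   ∎)

    -- The overshoot is at least halved, `h + h ≤ suc e`, and the factor 2/3 follows.
    3h≤2e : 3 * h ≤ 2 * suc e
    3h≤2e = begin
      3 * h            ≤⟨ *-monoˡ-≤ h (n≤1+n 3) ⟩
      4 * h            ≡⟨ double h ⟩
      2 * (h + h)      ≤⟨ *-monoʳ-≤ 2 (begin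
        h + h                      ≤⟨ +-monoʳ-≤ h (⌊n/2⌋≤⌈n/2⌉ (suc e)) ⟩
        h + ⌈ suc e /2⌉            ≡⟨ ⌊n/2⌋+⌈n/2⌉≡n (suc e) ⟩
        suc e                      ∎) ⟩
      2 * suc e        ∎
      where
      double : ∀ h → 4 * h ≡ 2 * (h + h)
      double = solve-∀

    scaled′ : 3 ^ suc w * h ≤ 2 ^ suc w * t
    scaled′ = begin
      3 * 3 ^ w * h           ≡⟨ assoc₁ (3 ^ w) h ⟩
      3 ^ w * (3 * h)         ≤⟨ *-monoʳ-≤ (3 ^ w) (≤-trans 3h≤2e (*-monoʳ-≤ 2 e<excess)) ⟩
      3 ^ w * (2 * excess)    ≡⟨ assoc₂ (3 ^ w) excess ⟩
      2 * (3 ^ w * excess)    ≤⟨ *-monoʳ-≤ 2 scaled ⟩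
      2 * (2 ^ w * t)         ≡⟨ *-assoc 2 (2 ^ w) t ⟨
      2 * 2 ^ w * t           ∎
      where
      assoc₁ : ∀ u h → 3 * u * h ≡ u * (3 * h)
      assoc₁ = solve-∀
      assoc₂ : ∀ u e → u * (2 * e) ≡ 2 * (u * e)
      assoc₂ = solve-∀

-- Embedding forests into the graphs G

Unique-++⁻ : ∀ {A : Set} (xs : List A) {ys} → Unique (xs ++ ys) → Unique xs × Unique ys × Disjoint xs ys
Unique-++⁻ []       u        = [] , u , λ { (() , _) }
Unique-++⁻ (x ∷ xs) (x# ∷ u) =
  let uxs , uys , disj = Unique-++⁻ xs u in
  All.tabulate (λ z∈ → All.lookup x# (∈-++⁺ˡ z∈)) ∷ uxs , uys ,
  λ { (here refl , y∈) → All.lookup x# (∈-++⁺ʳ xs y∈) refl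
    ; (there x∈ , y∈)  → disj (x∈ , y∈) }

Unique-resp-↭ : ∀ {A : Set} {xs ys : List A} → xs ↭ ys → Unique xs → Unique ys
Unique-resp-↭ {A} = Permutationₛ.Unique-resp-↭ (setoid A) ∘ ↭⇒↭ₛ

-- All parts of a forest share the vertex type `A`, so maps are total on `A` and constrained only on
-- the listed vertices.
InjectiveOn : {A B : Set} → List A → (A → B) → Set
InjectiveOn xs f = ∀ {x y} → x ∈ xs → y ∈ xs → f x ≡ f y → x ≡ y

module _ {A : Set} where

  Edge-ends : ∀ {F : Forest A} {u v} → Edge F u v → u ∈ verts F × v ∈ verts F
  Edge-ends {node a cs ss} (top c∈)     = here refl , there (∈-++⁺ˡ (roots⊆verts cs c∈))
  Edge-ends {node a cs ss} (inside e)   = let u∈ , v∈ = Edge-ends e in there (∈-++⁺ˡ u∈) , there (∈-++⁺ˡ v∈)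
  Edge-ends {node a cs ss} (sideways e) = let u∈ , v∈ = Edge-ends e in
    there (∈-++⁺ʳ (verts cs) u∈) , there (∈-++⁺ʳ (verts cs) v∈)

  Edge-irrefl : ∀ {F : Forest A} {u v} → Unique (verts F) → Edge F u v → u ≢ v
  Edge-irrefl {node a cs ss} (a# ∷ _) (top c∈)     = All.lookup a# (∈-++⁺ˡ (roots⊆verts cs c∈))
  Edge-irrefl {node a cs ss} (_ ∷ u)  (inside e)   = Edge-irrefl (proj₁ (Unique-++⁻ (verts cs) u)) e
  Edge-irrefl {node a cs ss} (_ ∷ u)  (sideways e) = Edge-irrefl (proj₁ (proj₂ (Unique-++⁻ (verts cs) u))) e

  record Embeds (F : Forest A) (H : Graph) : Set where
    field
      to     : A → V H
      to-inj : InjectiveOn (verts F) to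
      to-hom : ∀ {u v} → Edge F u v → E H (to u) (to v)

module _ {A : Set} (_≟_ : DecidableEquality A) where
  open DecMembership _≟_ using (_∈?_)

  injectionIntoFin : ∀ (xs : List A) {n} → length xs ≤ n → 0 < n → ∃ λ (f : A → Fin n) → InjectiveOn xs f
  injectionIntoFin xs {n} xs≤n 0<n = f , f-inj
    where
    f : A → Fin n
    f x with x ∈? xs
    ... | yes x∈ = inject≤ (index x∈) xs≤n
    -- A default value off the list; this is where `0 < n` enters.
    ... | no  _  = fromℕ< 0<n

    f-inj : InjectiveOn xs f
    f-inj {x} {y} x∈ y∈ eq with x ∈? xs | y ∈? xs
    ... | yes x∈′ | yes y∈′ = index-injective (setoid A) x∈′ y∈′ (inject≤-injective xs≤n xs≤n _ _ eq)
    ... | no x∉   | _       = ⊥-elim (x∉ x∈)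
    ... | yes _   | no y∉   = ⊥-elim (y∉ y∈)

  embed-K : ∀ {F n} → Unique (verts F) → size F ≤ n → 0 < n → Embeds F (K n)
  embed-K {F} u F≤n 0<n =
    let f , f-inj = injectionIntoFin (verts F) (≤-trans (≤-reflexive (length-verts F)) F≤n) 0<n in
    record { to = f ; to-inj = f-inj
           ; to-hom = λ e eq → let u∈ , v∈ = Edge-ends e in Edge-irrefl u e (f-inj u∈ v∈ eq) }

  module _ {F : Forest A} (s : Split F) (F! : Unique (verts F)) where
    open Split s

    private
      cover! = Unique-++⁻ sep (Unique-resp-↭ cover F!)
      parts! = Unique-++⁻ (verts left) (proj₁ (proj₂ cover!))

    left! : Unique (verts left)
    left! = proj₁ parts!

    right! : Unique (verts right)
    right! = proj₁ (proj₂ parts!)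

    -- The separator goes into the complete graph, which is joined to everything, and the parts go
    -- into the two copies. No edge of `F` runs between the parts, so none is needed between the
    -- copies.
    embed-step : ∀ {w H} → (∃ λ (g : A → Fin (suc w)) → InjectiveOn sep g) →
      Embeds left H → Embeds right H → Embeds F (step w H)
    embed-step {w} {H} (g , g-inj) eL eR = record { to = f ; to-inj = f-inj ; to-hom = λ e → f-hom e (edge e) }
      where
      module L = Embeds eL
      module R = Embeds eR

      f : A → V (step w H)
      f x with x ∈? sep | x ∈? verts left
      ... | yes _ | _     = inj₁ (g x)
      ... | no _  | yes _ = inj₂ (inj₁ (L.to x))
      ... | no _  | no _  = inj₂ (inj₂ (R.to x))

      f-sep : ∀ {x} → x ∈ sep → f x ≡ inj₁ (g x)
      f-sep {x} x∈ with x ∈? sep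
      ... | yes _ = refl
      ... | no x∉ = ⊥-elim (x∉ x∈)

      f-left : ∀ {x} → x ∈ verts left → f x ≡ inj₂ (inj₁ (L.to x))
      f-left {x} x∈ with x ∈? sep | x ∈? verts left
      ... | yes x∈s | _     = ⊥-elim (proj₂ (proj₂ cover!) (x∈s , ∈-++⁺ˡ x∈))
      ... | no _    | yes _ = refl
      ... | no _    | no x∉ = ⊥-elim (x∉ x∈)

      f-right : ∀ {x} → x ∈ verts right → f x ≡ inj₂ (inj₂ (R.to x))
      f-right {x} x∈ with x ∈? sep | x ∈? verts left
      ... | yes x∈s | _       = ⊥-elim (proj₂ (proj₂ cover!) (x∈s , ∈-++⁺ʳ (verts left) x∈))
      ... | no _    | yes x∈l = ⊥-elim (proj₂ (proj₂ parts!) (x∈l , x∈))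
      ... | no _    | no _    = refl

      -- A view indexed by the value of `f`, so that matching on the region of a vertex also reveals
      -- its image.
      data Place (x : A) : V (step w H) → Set where
        in-sep   : x ∈ sep → Place x (inj₁ (g x))
        in-left  : x ∈ verts left → Place x (inj₂ (inj₁ (L.to x)))
        in-right : x ∈ verts right → Place x (inj₂ (inj₂ (R.to x)))

      place : ∀ {x} → x ∈ verts F → Place x (f x)
      place {x} x∈ = [ (λ p → subst (Place x) (sym (f-sep p)) (in-sep p))
                     , [ (λ p → subst (Place x) (sym (f-left p)) (in-left p))
                       , (λ p → subst (Place x) (sym (f-right p)) (in-right p)) ]′ ∘ ∈-++⁻ (verts left)
                     ]′ (∈-++⁻ sep (∈-resp-↭ cover x∈))

      place-inj : ∀ {x y z z′} → Place x z → Place y z′ → z ≡ z′ → x ≡ y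
      place-inj (in-sep x∈)   (in-sep y∈)   eq = g-inj x∈ y∈ (inj₁-injective eq)
      place-inj (in-left x∈)  (in-left y∈)  eq = L.to-inj x∈ y∈ (inj₁-injective (inj₂-injective eq))
      place-inj (in-right x∈) (in-right y∈) eq = R.to-inj x∈ y∈ (inj₂-injective (inj₂-injective eq))

      f-inj : InjectiveOn (verts F) f
      f-inj x∈ y∈ = place-inj (place x∈) (place y∈)

      joined : ∀ {x y z z′} → x ≢ y → Place x z → Place y z′ → x ∈ sep ⊎ y ∈ sep →
               z ≡ f x → z′ ≡ f y → E (step w H) z z′
      joined x≢y (in-sep x∈) (in-sep y∈) _ _ _ = x≢y ∘ g-inj x∈ y∈
      joined _ (in-sep _) (in-left _)  _ _ _ = tt
      joined _ (in-sep _) (in-right _) _ _ _ = tt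
      joined _ (in-left _)  (in-sep _) _ _ _ = tt
      joined _ (in-right _) (in-sep _) _ _ _ = tt
      -- A separator vertex has its image in the complete graph, never in a copy.
      joined _ (in-left _)  _ (inj₁ x∈) eq _ with () ← trans eq (f-sep x∈)
      joined _ (in-right _) _ (inj₁ x∈) eq _ with () ← trans eq (f-sep x∈)
      joined _ _ (in-left _)  (inj₂ y∈) _ eq with () ← trans eq (f-sep y∈)
      joined _ _ (in-right _) (inj₂ y∈) _ eq with () ← trans eq (f-sep y∈)

      f-hom : ∀ {u v} → Edge F u v → (u ∈ sep ⊎ v ∈ sep) ⊎ (Edge left u v ⊎ Edge right u v) →
              E (step w H) (f u) (f v)
      f-hom e (inj₁ uv∈) = let u∈ , v∈ = Edge-ends e in
        joined (Edge-irrefl F! e) (place u∈) (place v∈) uv∈ refl refl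
      f-hom _ (inj₂ (inj₁ e)) = let u∈ , v∈ = Edge-ends e in
        subst (λ z → E (step w H) z _) (sym (f-left u∈))
          (subst (E (step w H) (inj₂ (inj₁ _))) (sym (f-left v∈)) (L.to-hom e))
      f-hom _ (inj₂ (inj₂ e)) = let u∈ , v∈ = Edge-ends e in
        subst (λ z → E (step w H) z _) (sym (f-right u∈))
          (subst (E (step w H) (inj₂ (inj₂ _))) (sym (f-right v∈)) (R.to-hom e))

  module _ (w n q : ℕ) where
    private
      a b c d : ℕ
      a = 3 ^ w
      b = 2 ^ w
      c = a + b
      d = 2 * a + b

      instance
        a≢0 : NonZero a
        a≢0 = nza w
        c≢0 : NonZero c
        c≢0 = nzab w

    open ≤-Reasoning

    module _ (p t : ℕ) (t-lower : t * c ^ suc p ≤ a * d ^ p) (t-upper : a * d ^ p ≤ suc t * c ^ suc p) where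

      -- Here `t` is at most α(w,p+1), and l - 1 ≤ t + e ≤ (1 + (2/3)^w) t, while (1 + (2/3)^w)
      -- α(w,p+1) = γ(w,p).
      left-bound : ∀ {l e} → l ≤ suc t + e → a * e ≤ b * t → (l ∸ 1) * c ^ p ≤ d ^ p
      left-bound {l} {e} l≤ ae≤bt = *-cancelˡ-≤ (a * c) {{m*n≢0 a c}} (begin
        a * c * ((l ∸ 1) * c ^ p)    ≡⟨ arrange₁ a c (l ∸ 1) (c ^ p) ⟩
        a * (l ∸ 1) * (c * c ^ p)    ≤⟨ *-monoˡ-≤ (c * c ^ p) (begin
          a * (l ∸ 1)                  ≤⟨ *-monoʳ-≤ a (∸-monoˡ-≤ 1 l≤) ⟩
          a * (t + e)                  ≡⟨ *-distribˡ-+ a t e ⟩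
          a * t + a * e                ≤⟨ +-monoʳ-≤ (a * t) ae≤bt ⟩
          a * t + b * t                ≡⟨ *-distribʳ-+ t a b ⟨
          c * t                        ∎) ⟩
        c * t * (c * c ^ p)          ≡⟨ *-assoc c t _ ⟩
        c * (t * (c * c ^ p))        ≤⟨ *-monoʳ-≤ c t-lower ⟩
        c * (a * d ^ p)              ≡⟨ arrange₂ a c (d ^ p) ⟩
        a * c * d ^ p                ∎)
        where
        arrange₁ : ∀ a c l x → a * c * (l * x) ≡ a * l * (c * x)
        arrange₁ = solve-∀
        arrange₂ : ∀ a c x → c * (a * x) ≡ a * c * x
        arrange₂ = solve-∀

      -- Since `suc t` is at least α(w,p+1), the claim comes from γ(w,p+1) - α(w,p+1) = γ(w,p),
      -- which is the identity d - a = c.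
      right-bound : ∀ {r m} → r + suc t ≤ m → (m ∸ 1) * c ^ suc p ≤ d ^ suc p → (r ∸ 1) * c ^ p ≤ d ^ p
      right-bound {zero}  {m} _  _ = z≤n
      right-bound {suc r} {m} r≤ m-bound = *-cancelˡ-≤ c (+-cancelʳ-≤ (a * d ^ p) _ _ (begin
        c * (r * c ^ p) + a * d ^ p            ≤⟨ +-monoʳ-≤ (c * (r * c ^ p)) t-upper ⟩
        c * (r * c ^ p) + suc t * (c * c ^ p)  ≡⟨ arrange₁ c r (c ^ p) (suc t) ⟩
        (r + suc t) * (c * c ^ p)              ≤⟨ *-monoˡ-≤ (c * c ^ p) (∸-monoˡ-≤ 1 r≤) ⟩
        (m ∸ 1) * (c * c ^ p)                  ≤⟨ m-bound ⟩
        d * d ^ p                              ≡⟨ arrange₂ a b (d ^ p) ⟩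
        c * d ^ p + a * d ^ p                  ∎))
        where
        arrange₁ : ∀ c r x s → c * (r * x) + s * (c * x) ≡ (r + s) * (c * x)
        arrange₁ = solve-∀
        arrange₂ : ∀ a b x → (2 * a + b) * x ≡ (a + b) * x + a * x
        arrange₂ = solve-∀

    -- The induction is over forests with at most γ + 1 vertices: the parts of a tree are forests,
    -- and it is the number of vertices that the separator controls. With `q` as p_w, `k` is p -
    -- p_w.
    embed-iter : (∀ m → m * c ^ q ≤ d ^ q → m < n) →
      ∀ k F → Unique (verts F) → (size F ∸ 1) * c ^ (k + q) ≤ d ^ (k + q) → Embeds F (iter w n k)
    embed-iter base zero F F! F≤ = embed-K F! (≤-trans (m≤n+m∸n (size F) 1) (base _ F≤)) (base 0 z≤n)
    embed-iter base (suc k) F F! F≤ = result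
      where
      p t : ℕ
      p = k + q

      instance
        c^≢0 : NonZero (c ^ suc p)
        c^≢0 = m^n≢0 c (suc p)

      t = (a * d ^ p) ℕ./ c ^ suc p

      t-lower : t * c ^ suc p ≤ a * d ^ p
      t-lower = m/n*n≤m (a * d ^ p) (c ^ suc p)

      t-upper : a * d ^ p ≤ suc t * c ^ suc p
      t-upper = begin
        a * d ^ p                                       ≡⟨ m≡m%n+[m/n]*n (a * d ^ p) (c ^ suc p) ⟩
        (a * d ^ p) % c ^ suc p + t * c ^ suc p         ≤⟨ +-monoˡ-≤ _ (<⇒≤ (m%n<n (a * d ^ p) (c ^ suc p))) ⟩
        suc t * c ^ suc p                               ∎

      glue : (s : Split F) → length (Split.sep s) ≤ suc w →
        (size (Split.left s) ∸ 1) * c ^ p ≤ d ^ p → (size (Split.right s) ∸ 1) * c ^ p ≤ d ^ p →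
        Embeds F (iter w n (suc k))
      glue s few l≤ r≤ = embed-step s F! (injectionIntoFin (Split.sep s) few z<s)
        (embed-iter base k _ (left! s F!) l≤) (embed-iter base k _ (right! s F!) r≤)

      result : Embeds F (iter w n (suc k))
      result with suc t ≤? size F
      ... | yes t<F = glue split few (left-bound p t t-lower t-upper leftˢ scaled)
                                     (right-bound p t t-lower t-upper rightˢ F≤)
        where open Separator (separator w t F t<F)
      -- At most `t` vertices: all of `F` goes into one copy, with excess 0.
      ... | no t≮F = glue (trivialSplit F) z≤n
        (left-bound p t t-lower t-upper {e = 0}
          (≤-trans (<⇒≤ (≰⇒> t≮F)) (m≤m+n (suc t) 0)) (≤-trans (≤-reflexive (*-zeroʳ a)) z≤n))
        z≤n

-- Acyclic graphs as forests

module _ {A : Set} where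

  -- `keepsᵣ` makes the `top` edges of an enclosing vertex survive the recursion.
  record Insertion (v y : A) (F : Forest A) : Set where
    field
      result  : Forest A
      added   : verts result ↭ v ∷ verts F
      keeps   : ∀ {u w} → Edge F u w → Edge result u w
      below   : Edge result y v
      keepsᵣ  : ∀ {x} → x ∈ roots F → x ∈ roots result

  insertUnder : ∀ v {y} F → y ∈ verts F → Insertion v y F
  insertUnder v (node a cs ss) (here refl) = record
    { result = node a (node v ∅ cs) ss
    ; added  = solve 4 (λ v a c s → a ⊕ ((v ⊕ c) ⊕ s) ⊜ v ⊕ (a ⊕ (c ⊕ s))) ↭-refl [ v ] [ a ] (verts cs) (verts ss)
    ; keeps  = λ { (top c∈) → top (there c∈) ; (inside e) → inside (sideways e) ; (sideways e) → sideways e }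
    ; below  = top (here refl) ; keepsᵣ = id }
    where open ↭-Solver
  insertUnder v (node a cs ss) (there y∈) with ∈-++⁻ (verts cs) y∈
  ... | inj₁ y∈cs = record
    { result = node a result ss
    ; added  = ↭-trans (↭-prep a (++⁺ʳ (verts ss) added))
        (solve 4 (λ v a c s → a ⊕ ((v ⊕ c) ⊕ s) ⊜ v ⊕ (a ⊕ (c ⊕ s))) ↭-refl [ v ] [ a ] (verts cs) (verts ss))
    ; keeps  = λ { (top c∈) → top (keepsᵣ c∈) ; (inside e) → inside (keeps e) ; (sideways e) → sideways e }
    ; below  = inside below ; keepsᵣ = λ { (here eq) → here eq ; (there x∈) → there x∈ } }
    where open Insertion (insertUnder v cs y∈cs)
          open ↭-Solver
  ... | inj₂ y∈ss = record
    { result = node a cs result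
    ; added  = ↭-trans (↭-prep a (++⁺ˡ (verts cs) added))
        (solve 4 (λ v a c s → a ⊕ (c ⊕ (v ⊕ s)) ⊜ v ⊕ (a ⊕ (c ⊕ s))) ↭-refl [ v ] [ a ] (verts cs) (verts ss))
    ; keeps  = λ { (top c∈) → top c∈ ; (inside e) → inside e ; (sideways e) → sideways (keeps e) }
    ; below  = sideways below ; keepsᵣ = λ { (here eq) → here eq ; (there x∈) → there (keepsᵣ x∈) } }
    where open Insertion (insertUnder v ss y∈ss)
          open ↭-Solver

module _ {n : ℕ} (T : FinGraph n) where
  open DecMembership (Fin._≟_ {n}) using (_∈?_)

  Adj-sym : ∀ {u v} → Adj T u v → Adj T v u
  Adj-sym {u} {v} = trans (adj-sym T v u)

  Adj-irrefl : ∀ {u} → Adj T u u → ⊥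
  Adj-irrefl {u} uu with () ← trans (sym uu) (adj-irrefl T u)

  -- Isolated vertices count as leaves, with an arbitrary `y`.
  Leaf : List (Fin n) → Fin n → Set
  Leaf L v = ∃ λ y → ∀ {z} → z ∈ L → Adj T v z → z ≡ y

  -- Only the indices below `m` matter. The path is extended at index 0.
  record Path (L : List (Fin n)) (m : ℕ) : Set where
    field
      at     : ℕ → Fin n
      at-inj : ∀ {i j} → i < m → j < m → at i ≡ at j → i ≡ j
      at-adj : ∀ {i} → suc i < m → Adj T (at i) (at (suc i))
      at∈    : ∀ {i} → i < m → at i ∈ L

    short : m ≤ n
    short = injective⇒≤ {f = at ∘ toℕ} (λ {i} {j} eq → toℕ-injective (at-inj (toℕ<n i) (toℕ<n j) eq))

  open Path

  edgePath : ∀ {L u v} → u ∈ L → v ∈ L → Adj T u v → Path L 2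
  edgePath {L} {u} {v} u∈ v∈ uv = record { at = f ; at-inj = f-inj ; at-adj = f-adj ; at∈ = f∈ }
    where
    f : ℕ → Fin n
    f zero    = u
    f (suc _) = v

    f-inj : ∀ {i j} → i < 2 → j < 2 → f i ≡ f j → i ≡ j
    f-inj {0} {0} _ _ _ = refl
    f-inj {0} {1} _ _ refl = ⊥-elim (Adj-irrefl uv)
    f-inj {1} {0} _ _ refl = ⊥-elim (Adj-irrefl uv)
    f-inj {1} {1} _ _ _ = refl
    f-inj {suc (suc _)} (s≤s (s≤s ()))
    f-inj {j = suc (suc _)} _ (s≤s (s≤s ()))

    f-adj : ∀ {i} → suc i < 2 → Adj T (f i) (f (suc i))
    f-adj {zero}  _ = uv
    f-adj {suc _} (s≤s (s≤s ()))

    f∈ : ∀ {i} → i < 2 → f i ∈ L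
    f∈ {zero}  _ = u∈
    f∈ {suc _} _ = v∈

  extendPath : ∀ {L m z} (p : Path L m) → z ∈ L → Adj T (at p 0) z → (∀ {i} → i < m → at p i ≢ z) → Path L (suc m)
  extendPath {L} {m} {z} p z∈ adj₀ fresh = record { at = f ; at-inj = f-inj ; at-adj = f-adj ; at∈ = f∈ }
    where
    f : ℕ → Fin n
    f zero    = z
    f (suc i) = at p i

    f-inj : ∀ {i j} → i < suc m → j < suc m → f i ≡ f j → i ≡ j
    f-inj {zero}  {zero}  _ _ _ = refl
    f-inj {zero}  {suc j} _ (s≤s j<) eq = ⊥-elim (fresh j< (sym eq))
    f-inj {suc i} {zero}  (s≤s i<) _ eq = ⊥-elim (fresh i< eq)
    f-inj {suc i} {suc j} (s≤s i<) (s≤s j<) eq = cong suc (at-inj p i< j< eq)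

    f-adj : ∀ {i} → suc i < suc m → Adj T (f i) (f (suc i))
    f-adj {zero}  _        = Adj-sym adj₀
    f-adj {suc i} (s≤s i<) = at-adj p i<

    f∈ : ∀ {i} → i < suc m → f i ∈ L
    f∈ {zero}  _        = z∈
    f∈ {suc i} (s≤s i<) = at∈ p i<

  closedPath⇒Cycle : ∀ {L m} j (p : Path L m) → 2 + j < m → Adj T (at p 0) (at p (2 + j)) → Cycle T
  closedPath⇒Cycle {m = m} j p j< closing = j , at p ∘ toℕ
    , (λ {x} {y} eq → toℕ-injective (at-inj p (bound x) (bound y) eq))
    , (λ i → subst (λ k → Adj T (at p k) (at p (suc (toℕ i)))) (sym (toℕ-inject₁ i)) (at-adj p (bound (suc i))))
    , subst (λ k → Adj T (at p k) (at p 0)) (sym (toℕ-fromℕ (2 + j))) (Adj-sym closing)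
    where
    bound : (x : Fin (3 + j)) → toℕ x < m
    bound x = ≤-trans (toℕ<n x) j<

  module _ (acyclic : Acyclic T) where

    -- A path is extended until its first vertex has no neighbour in `L` except its successor. A
    -- path has at most `n` vertices, so the fuel cannot run out.
    climb : ∀ {L} fuel k → n ≤ fuel + suc k → Path L (2 + k) → ∃ λ v → v ∈ L × Leaf L v
    climb zero k n≤ p = ⊥-elim (<-irrefl refl (≤-trans (short p) n≤))
    climb {L} (suc fuel) k n≤ p
      with any? (λ z → (adj T (at p 0) z Bool.≟ true) ×-dec ¬? (z Fin.≟ at p 1)) L
    ... | no stuck = at p 0 , at∈ p z<s , at p 1 ,
          λ {z} z∈ 0z → decidable-stable (z Fin.≟ at p 1) (λ z≢ → stuck (lose z∈ (0z , z≢)))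
    ... | yes next with find next
    ... | z , z∈ , 0z , z≢1 with anyUpTo? (λ i → at p i Fin.≟ z) (2 + k)
    ... | no fresh = climb fuel (suc k) (≤-trans n≤ (≤-reflexive (sym (+-suc fuel (suc k)))))
                       (extendPath p z∈ 0z (λ i< eq → fresh (_ , i< , eq)))
    -- A neighbour already on the path would be a loop, the excluded successor, or the end of a
    -- chord that closes a cycle.
    ... | yes (zero        , _  , refl) = ⊥-elim (Adj-irrefl 0z)
    ... | yes (suc zero    , _  , refl) = ⊥-elim (z≢1 refl)
    ... | yes (suc (suc j) , j< , refl) = ⊥-elim (acyclic (closedPath⇒Cycle j p j< 0z))

    leaf-exists : ∀ {L x} → x ∈ L → ∃ λ v → v ∈ L × Leaf L v
    leaf-exists {L} {x} x∈ with any? (λ z → adj T x z Bool.≟ true) L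
    ... | no isolated = x , x∈ , x , λ z∈ xz → ⊥-elim (isolated (lose z∈ xz))
    ... | yes nbr with find nbr
    ... | z , z∈ , xz = climb n 0 (m≤m+n n 1) (edgePath x∈ z∈ xz)

    -- Only the inclusion of the edges of `T` in the forest is asked for, in either direction, as an
    -- embedding requires no more.
    record SpannedBy (L : List (Fin n)) : Set where
      field
        forest  : Forest (Fin n)
        spans   : verts forest ↭ L
        catches : ∀ {u w} → u ∈ L → w ∈ L → Adj T u w → Edge forest u w ⊎ Edge forest w u

    -- A leaf is hung below `y` if `y` is in the forest; otherwise it has no neighbour in `L` and
    -- starts a tree of its own.
    spanned-∷ : ∀ {L v} → Leaf (v ∷ L) v → SpannedBy L → SpannedBy (v ∷ L)
    spanned-∷ {L} {v} (y , leaf) s with y ∈? verts (SpannedBy.forest s)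
    ... | yes y∈ = record { forest = result ; spans = ↭-trans added (↭-prep v spans) ; catches = catches′ }
      where
      open SpannedBy s
      open Insertion (insertUnder v forest y∈)

      to-leaf : ∀ {w} → w ∈ L → Adj T v w → Edge result w v
      to-leaf w∈ vw = subst (λ x → Edge result x v) (sym (leaf (there w∈) vw)) below

      catches′ : ∀ {u w} → u ∈ v ∷ L → w ∈ v ∷ L → Adj T u w → Edge result u w ⊎ Edge result w u
      catches′ (here refl) (here refl) vv = ⊥-elim (Adj-irrefl vv)
      catches′ (here refl) (there w∈)  vw = inj₂ (to-leaf w∈ vw)
      catches′ (there u∈)  (here refl) uv = inj₁ (to-leaf u∈ (Adj-sym uv))
      catches′ (there u∈)  (there w∈)  uw = Sum.map keeps keeps (catches u∈ w∈ uw)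
    ... | no y∉ = record { forest = node v ∅ forest ; spans = ↭-prep v spans ; catches = catches′ }
      where
      open SpannedBy s

      isolated : ∀ {w} → w ∈ L → Adj T v w → ⊥
      isolated w∈ vw = y∉ (subst (_∈ verts forest) (leaf (there w∈) vw) (∈-resp-↭ (↭-sym spans) w∈))

      catches′ : ∀ {u w} → u ∈ v ∷ L → w ∈ v ∷ L → Adj T u w →
                 Edge (node v ∅ forest) u w ⊎ Edge (node v ∅ forest) w u
      catches′ (here refl) (here refl) vv = ⊥-elim (Adj-irrefl vv)
      catches′ (here refl) (there w∈)  vw = ⊥-elim (isolated w∈ vw)
      catches′ (there u∈)  (here refl) uv = ⊥-elim (isolated u∈ (Adj-sym uv))
      catches′ (there u∈)  (there w∈)  uw = Sum.map sideways sideways (catches u∈ w∈ uw)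

    spanned-↭ : ∀ {L L′} → L ↭ L′ → SpannedBy L → SpannedBy L′
    spanned-↭ L↭L′ s = record
      { forest = forest ; spans = ↭-trans spans L↭L′
      ; catches = λ u∈ w∈ → catches (∈-resp-↭ (↭-sym L↭L′) u∈) (∈-resp-↭ (↭-sym L↭L′) w∈) }
      where open SpannedBy s

    -- Leaves are peeled off one by one. The length is the recursion measure, because a leaf may sit
    -- anywhere in the list.
    spanningForest : ∀ m L → length L ≡ m → SpannedBy L
    spanningForest m [] _ = record { forest = ∅ ; spans = ↭-refl ; catches = λ () }
    spanningForest (suc m) L@(_ ∷ _) len =
      let v , v∈ , y , leaf = leaf-exists {L} (here refl)
          xs , ys , L≡ = ∈-∃++ v∈
          L↭ = ↭-trans (↭-reflexive L≡) (shift v xs ys)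
      in spanned-↭ (↭-sym L↭) (spanned-∷ (y , leaf ∘ ∈-resp-↭ (↭-sym L↭))
           (spanningForest m (xs ++ ys) (suc-injective (trans (sym (↭-length L↭)) len))))

-- Counting the edges of a connected graph

module _ {A : Set} where

  sum-map-≤ : ∀ {f g : A → ℕ} → (∀ x → f x ≤ g x) → ∀ xs → sum (map f xs) ≤ sum (map g xs)
  sum-map-≤ f≤g []       = z≤n
  sum-map-≤ f≤g (x ∷ xs) = +-mono-≤ (f≤g x) (sum-map-≤ f≤g xs)

  sum-map-< : ∀ {f g : A → ℕ} → (∀ x → f x ≤ g x) → ∀ {x xs} → x ∈ xs → f x < g x → sum (map f xs) < sum (map g xs)
  sum-map-< f≤g {xs = _ ∷ xs} (here refl) f<g = +-mono-<-≤ f<g (sum-map-≤ f≤g xs)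
  sum-map-< f≤g {xs = x ∷ _}  (there x∈)  f<g = +-mono-≤-< (f≤g x) (sum-map-< f≤g x∈ f<g)

  ≤-sum-map : ∀ (f : A → ℕ) {x xs} → x ∈ xs → f x ≤ sum (map f xs)
  ≤-sum-map f {xs = _ ∷ xs} (here refl) = m≤m+n _ (sum (map f xs))
  ≤-sum-map f {xs = y ∷ _}  (there x∈)  = ≤-trans (≤-sum-map f x∈) (m≤n+m _ (f y))

module _ {n : ℕ} (T : FinGraph n) where

  edge# : Fin n → Fin n → ℕ
  edge# i j = if adj T i j ∧ (toℕ i <ᵇ toℕ j) then 1 else 0

  edge#-Adj : ∀ {i j} → Adj T i j → toℕ i < toℕ j → edge# i j ≡ 1
  edge#-Adj {i} {j} ij i<j with adj T i j | toℕ i <ᵇ toℕ j | <⇒<ᵇ i<j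
  edge#-Adj refl _ | .true | true | _ = refl

  -- At `allFin n` this is `edgeCount T`; general lists allow adding one vertex at a time.
  edgesIn : List (Fin n) → ℕ
  edgesIn L = sum (map (λ i → sum (map (edge# i) L)) L)

  edgesIn-↭ : ∀ {L L′} → L ↭ L′ → edgesIn L ≡ edgesIn L′
  edgesIn-↭ {L} {L′} p = trans (sum-↭ (map⁺ _ p)) (cong sum (map-cong (λ i → sum-↭ (map⁺ (edge# i) p)) L′))

  -- The new edge is counted in the row of its smaller end: in the new column of row `x`, or in the
  -- new row `y`.
  edgesIn-∷ : ∀ {L x y} → x ∈ L → Adj T x y → suc (edgesIn L) ≤ edgesIn (y ∷ L)
  edgesIn-∷ {L} {x} {y} x∈ xy with <-cmp (toℕ x) (toℕ y)
  ... | tri< x<y _ _ = ≤-trans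
    (sum-map-< {f = λ i → sum (map (edge# i) L)} (λ i → m≤n+m _ (edge# i y)) x∈
      (+-monoˡ-≤ (sum (map (edge# x) L)) (≤-reflexive (sym (edge#-Adj xy x<y)))))
    (m≤n+m _ (edge# y y + sum (map (edge# y) L)))
  ... | tri> _ _ y<x = +-mono-≤
    (≤-trans (≤-trans (≤-reflexive (sym (edge#-Adj (Adj-sym T xy) y<x))) (≤-sum-map (edge# y) x∈))
             (m≤n+m _ (edge# y y)))
    (sum-map-≤ (λ i → m≤n+m _ (edge# i y)) L)
  ... | tri≈ _ x≡y _ = ⊥-elim (Adj-irrefl T (subst (Adj T x) (sym (toℕ-injective x≡y)) xy))

  module _ (connected : Connected T) where

    -- The first step of the walk that leaves `L` lands in `M`. A walk that never leaves would end
    -- in both, against uniqueness.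
    crossing : ∀ {L M} → L ++ M ↭ allFin n → ∀ k (f : Fin (suc k) → Fin n) →
      (∀ i → Adj T (f (inject₁ i)) (f (suc i))) → f zero ∈ L → f (fromℕ k) ∈ M →
      ∃₂ λ x y → x ∈ L × y ∈ M × Adj T x y
    crossing {L} LM zero f _ x∈ y∈ =
      ⊥-elim (proj₂ (proj₂ (Unique-++⁻ L (Unique-resp-↭ (↭-sym LM) (allFin⁺ n)))) (x∈ , y∈))
    crossing {L} LM (suc k) f steps x∈ y∈ =
      [ (λ x′∈ → crossing LM k (f ∘ suc) (steps ∘ suc) x′∈ y∈)
      , (λ x′∈ → _ , _ , x∈ , x′∈ , steps zero)
      ]′ (∈-++⁻ L (∈-resp-↭ (↭-sym LM) (∈-allFin (f (suc zero)))))

    -- Vertices move from `M` to `L` along crossing edges, and each brings a new edge with it.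
    grow : ∀ m {x} L M → length M ≡ m → L ++ M ↭ allFin n → x ∈ L → length L ≤ suc (edgesIn L) →
      n ≤ suc (edgeCount T)
    grow zero L [] _ LM x∈ L≤ = subst₂ _≤_ (trans (↭-length L↭) (length-tabulate id)) (cong suc (edgesIn-↭ L↭)) L≤
      where
      L↭ : L ↭ allFin n
      L↭ = ↭-trans (↭-reflexive (sym (++-identityʳ L))) LM
    grow (suc m) {x} L M@(z ∷ _) len LM x∈ L≤ =
      let k , f , f₀ , fₖ , steps = connected x z
          u , v , u∈ , v∈ , uv = crossing LM k f steps (subst (_∈ L) (sym f₀) x∈) (subst (_∈ M) (sym fₖ) (here refl))
          xs , ys , M≡ = ∈-∃++ v∈
          M↭ = ↭-trans (↭-reflexive M≡) (shift v xs ys)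
      in grow m (v ∷ L) (xs ++ ys) (suc-injective (trans (sym (↭-length M↭)) len))
           (↭-trans (↭-sym (shift v L (xs ++ ys))) (↭-trans (++⁺ˡ L (↭-sym M↭)) LM))
           (there x∈) (s≤s (≤-trans L≤ (edgesIn-∷ u∈ uv)))

connected⇒n≤1+edges : ∀ {n} (T : FinGraph n) → Connected T → n ≤ suc (edgeCount T)
connected⇒n≤1+edges {zero}  T connected = z≤n
connected⇒n≤1+edges {suc n} T connected =
  grow T connected n (zero ∷ []) _ (length-tabulate {n = n} suc) ↭-refl (here refl) (s≤s z≤n)

-- Rational bounds as inequalities between natural numbers

infix 4 _≃_∕_
-- Elements of `ℚ` are stored in lowest terms. The unnormalised form keeps the given numerator and
-- denominator available for cross-multiplication.
_≃_∕_ : ℚ → (n m : ℕ) .{{_ : NonZero m}} → Set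
q ≃ n ∕ m = toℚᵘ q ℚᵘ.≃ (+ n ℚᵘ./ m)

≃-/ : ∀ n m .{{_ : NonZero m}} → (+ n / m) ≃ n ∕ m
≃-/ n (suc m) = ℚ.toℚᵘ-fromℚᵘ (mkℚᵘ (+ n) m)

≃-* : ∀ {p q} n m n′ m′ .{{_ : NonZero m}} .{{_ : NonZero m′}} .{{_ : NonZero (m * m′)}} →
  p ≃ n ∕ m → q ≃ n′ ∕ m′ → (p ℚ.* q) ≃ n * n′ ∕ m * m′
≃-* {p} {q} n (suc m) n′ (suc m′) p≃ q≃ =
  ℚᵘ.≃-trans (ℚ.toℚᵘ-homo-* p q) (ℚᵘ.≃-trans (ℚᵘ.*-cong p≃ q≃)
    (*≡* (cong (ℤ._* + (suc m * suc m′)) (sym (ℤ.pos-* n n′)))))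

≃-pow : ∀ {q} n m .{{_ : NonZero m}} → q ≃ n ∕ m → ∀ k → let instance _ = m^n≢0 m k in powℚ q k ≃ n ^ k ∕ m ^ k
≃-pow n m q≃ zero = ℚᵘ.≃-refl
≃-pow n m q≃ (suc k) = ≃-* n m (n ^ k) (m ^ k) q≃ (≃-pow n m q≃ k)
  where instance _ = m^n≢0 m k
                 _ = m^n≢0 m (suc k)

≤⇒cross : ∀ {p q} n m n′ m′ .{{_ : NonZero m}} .{{_ : NonZero m′}} →
  p ≃ n ∕ m → q ≃ n′ ∕ m′ → p ℚ.≤ q → n * m′ ≤ n′ * m
≤⇒cross n (suc m) n′ (suc m′) p≃ q≃ p≤q = ℤ.drop‿+≤+
  (subst₂ ℤ._≤_ (sym (ℤ.pos-* n (suc m′))) (sym (ℤ.pos-* n′ (suc m)))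
    (ℚᵘ.drop-*≤* (ℚᵘ.≤-respʳ-≃ q≃ (ℚᵘ.≤-respˡ-≃ p≃ (ℚ.toℚᵘ-mono-≤ p≤q)))))

cross⇒≤ : ∀ {p q} n m n′ m′ .{{_ : NonZero m}} .{{_ : NonZero m′}} →
  p ≃ n ∕ m → q ≃ n′ ∕ m′ → n * m′ ≤ n′ * m → p ℚ.≤ q
cross⇒≤ n (suc m) n′ (suc m′) p≃ q≃ cross = ℚ.toℚᵘ-cancel-≤
  (ℚᵘ.≤-respʳ-≃ (ℚᵘ.≃-sym q≃) (ℚᵘ.≤-respˡ-≃ (ℚᵘ.≃-sym p≃)
    (*≤* (subst₂ ℤ._≤_ (ℤ.pos-* n (suc m′)) (ℤ.pos-* n′ (suc m)) (ℤ.+≤+ cross)))))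

floor*↧≤↥ : ∀ q → floor q ℤ.* ↧ q ℤ.≤ ↥ q
floor*↧≤↥ q@record{} = ℤ.[n/d]*d≤n (↥ q) (↧ q)

-- `ceiling q` is the negative of `floor (- q)`, so this is the bound for the floor, negated.
↥≤ceiling*↧ : ∀ q → ↥ q ℤ.≤ ceiling q ℤ.* ↧ q
↥≤ceiling*↧ q@record{} = begin
  ↥ q                              ≡⟨ ℤ.neg-involutive (↥ q) ⟨
  ℤ.- (ℤ.- ↥ q)                    ≡⟨ cong ℤ.-_ (ℚ.↥-neg q) ⟨
  ℤ.- (↥ (ℚ.- q))                  ≤⟨ ℤ.neg-mono-≤ (floor*↧≤↥ (ℚ.- q)) ⟩
  ℤ.- (floor (ℚ.- q) ℤ.* ↧ (ℚ.- q)) ≡⟨ cong (λ d → ℤ.- (floor (ℚ.- q) ℤ.* d)) (ℚ.↧-neg q) ⟩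
  ℤ.- (floor (ℚ.- q) ℤ.* ↧ q)      ≡⟨ ℤ.neg-distribˡ-* (floor (ℚ.- q)) (↧ q) ⟩
  ceiling q ℤ.* ↧ q                ∎
  where open ℤ.≤-Reasoning

+<⇒<∣∣ : ∀ {n} i → + n ℤ.< i → n < ℤ.∣ i ∣
+<⇒<∣∣ (+ _) (ℤ.+<+ n<m) = n<m

-- The ceiling exceeds a natural number, hence is positive and equals its absolute value.
<⇒<∣ceiling∣ : ∀ {n q} → (+ n / 1) ℚ.< q → n < ℤ.∣ ceiling q ∣
<⇒<∣ceiling∣ {n} {q@record{}} n<q with ℚᵘ.<-respˡ-≃ (≃-/ n 1) (ℚ.toℚᵘ-mono-< n<q)
... | *<* n*↧<↥ = +<⇒<∣∣ (ceiling q) (ℤ.*-cancelʳ-<-nonNeg (↧ q) (ℤ.<-≤-trans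
  (subst (+ n ℤ.* ↧ q ℤ.<_) (ℤ.*-identityʳ (↥ q)) n*↧<↥) (↥≤ceiling*↧ q)))

module _ (w : ℕ) where
  private
    a b c d : ℕ
    a = 3 ^ w
    b = 2 ^ w
    c = a + b
    d = 2 * a + b

    instance
      a≢0 : NonZero a
      a≢0 = nza w
      b≢0 : NonZero b
      b≢0 = nzb w
      c≢0 : NonZero c
      c≢0 = nzab w
      ab≢0 : NonZero (a * b)
      ab≢0 = m*n≢0 a b

  open ≤-Reasoning

  γ≃ : ∀ p → let instance _ = m^n≢0 c p in γ w p ≃ d ^ p ∕ c ^ p
  γ≃ p = ≃-pow d c (≃-/ d c) p

  ≤γ⇒ : ∀ m p → (+ m / 1) ℚ.≤ γ w p → m * c ^ p ≤ d ^ p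
  ≤γ⇒ m p m≤γ = ≤-trans (≤⇒cross m 1 (d ^ p) (c ^ p) (≃-/ m 1) (γ≃ p) m≤γ) (≤-reflexive (*-identityʳ (d ^ p)))
    where instance _ = m^n≢0 c p

  α≃ : ∀ p → let instance _ = m^n≢0 c (suc p) in α w (suc p) ≃ a * d ^ p ∕ c ^ suc p
  α≃ p = ≃-* a c (d ^ p) (c ^ p) (≃-/ a c) (γ≃ p)
    where instance _ = m^n≢0 c p
                   _ = m^n≢0 c (suc p)

  δ≃ : δ w ≃ d * (3 * a) ∕ a * b
  δ≃ = ≃-* d a (3 * a) b (≃-/ d a) (≃-/ (3 * a) b)

  cross<⇒<⌈δ⌉ : ∀ {m} → m * (a * b) < d * (3 * a) → m < ℤ.∣ ceiling (δ w) ∣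
  cross<⇒<⌈δ⌉ {m} cross = <⇒<∣ceiling∣ {q = δ w} (ℚ.≰⇒> λ δ≤m →
    <⇒≱ cross (≤-trans (≤-reflexive (sym (*-identityʳ _))) (≤⇒cross (d * (3 * a)) (a * b) m 1 δ≃ (≃-/ m 1) δ≤m)))

  -- For positive p_w, minimality gives α(w,p_w) < β(w), and multiplying by 2 + (2/3)^w turns this
  -- into γ(w,p_w) < δ(w).
  ≤γ[pw]⇒<⌈δ⌉ : ∀ pw → IsPw w pw → ∀ m → m * c ^ pw ≤ d ^ pw → m < ℤ.∣ ceiling (δ w) ∣
  -- There is no smaller index to appeal to, but γ(w,0) = 1 is below δ(w) directly.
  ≤γ[pw]⇒<⌈δ⌉ zero _ m m≤ = cross<⇒<⌈δ⌉ {m} (begin-strict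
    m * (a * b)          ≤⟨ *-monoˡ-≤ (a * b) (≤-trans (≤-reflexive (sym (*-identityʳ m))) m≤) ⟩
    1 * (a * b)          ≡⟨ *-identityˡ (a * b) ⟩
    a * b                <⟨ *-monoʳ-< a (m<n+m b {2 * a} (>-nonZero⁻¹ (2 * a) {{m*n≢0 2 a}})) ⟩
    a * d                ≤⟨ m≤n*m (a * d) 3 ⟩
    3 * (a * d)          ≡⟨ arrange a d ⟩
    d * (3 * a)          ∎)
    where
    arrange : ∀ a d → 3 * (a * d) ≡ d * (3 * a)
    arrange = solve-∀
  ≤γ[pw]⇒<⌈δ⌉ (suc q) (_ , minimal) m m≤ = cross<⇒<⌈δ⌉ {m} (*-cancelʳ-< (c ^ suc q) _ _ (begin-strict
    m * (a * b) * c ^ suc q        ≡⟨ arrange₁ m (a * b) (c ^ suc q) ⟩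
    a * b * (m * c ^ suc q)        ≤⟨ *-monoʳ-≤ (a * b) m≤ ⟩
    a * b * (d * d ^ q)            ≡⟨ arrange₂ a b d (d ^ q) ⟩
    d * (a * d ^ q * b)            <⟨ *-monoʳ-< d {{nz2ab w}} α<β ⟩
    d * (3 * a * c ^ suc q)        ≡⟨ *-assoc d (3 * a) (c ^ suc q) ⟨
    d * (3 * a) * c ^ suc q        ∎))
    where
    instance _ = m^n≢0 c (suc q)
    α<β : a * d ^ q * b < 3 * a * c ^ suc q
    α<β = ≰⇒> λ cross → 1+n≰n (minimal q (cross⇒≤ (3 * a) b (a * d ^ q) (c ^ suc q) (≃-/ (3 * a) b) (α≃ q) cross))
    arrange₁ : ∀ m x y → m * x * y ≡ x * (m * y)
    arrange₁ = solve-∀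
    arrange₂ : ∀ a b d x → a * b * (d * x) ≡ d * (a * x * b)
    arrange₂ = solve-∀

-- Symmetry of the graphs G and the embedding of trees

stepE-sym : ∀ {A : Set} w {e : A → A → Set} → (∀ x y → e x y → e y x) →
  ∀ x y → stepE w e x y → stepE w e y x
stepE-sym w e-sym (inj₁ _)        (inj₁ _)        i≢j = i≢j ∘ sym
stepE-sym w e-sym (inj₁ _)        (inj₂ _)        _   = tt
stepE-sym w e-sym (inj₂ _)        (inj₁ _)        _   = tt
stepE-sym w e-sym (inj₂ (inj₁ x)) (inj₂ (inj₁ y)) xy  = e-sym x y xy
stepE-sym w e-sym (inj₂ (inj₂ x)) (inj₂ (inj₂ y)) xy  = e-sym x y xy

-- Forest edges run from parent to child, whereas an edge of the tree may be met in either
-- direction.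
iter-sym : ∀ w n k x y → E (iter w n k) x y → E (iter w n k) y x
iter-sym w n zero    _ _ x≢y = x≢y ∘ sym
iter-sym w n (suc k) = stepE-sym w (iter-sym w n k)

theorem3p8 : (w pw : ℕ) → IsPw w pw → (p : ℕ) → pw ≤ p →
    (n : ℕ) (T : FinGraph n) → IsTree T →
    (+ edgeCount T / 1) ℚ.≤ γ w p →
    Contains (G w pw p) (toGraph T)
theorem3p8 w pw isPw p pw≤p n T (_ , connected , acyclic) e≤γ =
  to , to-inj (∈forest _) (∈forest _) ,
  λ {u} {v} uv → [ to-hom , iter-sym w _ (p ∸ pw) _ _ ∘ to-hom ]′ (catches (∈-allFin u) (∈-allFin v) uv)
  where
  open SpannedBy (spanningForest T acyclic n (allFin n) (length-tabulate id))

  ∈forest : ∀ i → _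
  ∈forest i = ∈-resp-↭ (↭-sym spans) (∈-allFin i)

  size≡n : size forest ≡ n
  size≡n = trans (sym (length-verts forest)) (trans (↭-length spans) (length-tabulate id))

  -- Connectedness turns the bound on edges into one on vertices: n - 1 is at most the number of
  -- edges, hence at most γ(w,p).
  bound : (size forest ∸ 1) * (3 ^ w + 2 ^ w) ^ p ≤ (2 * 3 ^ w + 2 ^ w) ^ p
  bound = ≤-trans
    (*-monoˡ-≤ _ (≤-trans (∸-monoˡ-≤ 1 (≤-reflexive size≡n)) (∸-monoˡ-≤ 1 (connected⇒n≤1+edges T connected))))
    (≤γ⇒ w (edgeCount T) p e≤γ)

  open Embeds (embed-iter Fin._≟_ w ℤ.∣ ceiling (δ w) ∣ pw (≤γ[pw]⇒<⌈δ⌉ w pw isPw) (p ∸ pw) forest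
    (Unique-resp-↭ (↭-sym spans) (allFin⁺ n))
    (subst (λ k → (size forest ∸ 1) * (3 ^ w + 2 ^ w) ^ k ≤ (2 * 3 ^ w + 2 ^ w) ^ k) (sym (m∸n+n≡m pw≤p)) bound))
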